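{- Let $\gamma=e^{2\pi i/3}$, let $\mathscr{D}$ be a mixed graph, let $B=B^\gamma(\mathscr{D})$ be its $\gamma$-incidence matrix and let $D=\operatorname{diag}((\deg(v))_{v\in V(\mathscr{D})})$. Then (i) $B^\ast B = H_\gamma(L_\gamma(\mathscr{D})) + 2I$, (ii) $B B^\ast = H_\gamma(\mathscr{D}) + D$.
   Context: A mixed graph is obtained from a finite simple undirected graph by orienting some (possibly none or all) of its edges into arcs; the unoriented edges are called digons. $\Gamma(\mathscr{D})$ denotes the underlying undirected graph of $\mathscr{D}$; a mixed orientation of an undirected graph $\mathscr{G}$ is a mixed graph with underlying graph $\mathscr{G}$. $\deg(v)$ is the degree of $v$ in $\Gamma(\mathscr{D})$. The edges of $\mathscr{D}$ (arcs and digons) correspond to the edges of $\Gamma(\mathscr{D})$. $M^\ast$ denotes the conjugate transpose. $\gamma$-Hermitian adjacency matrix $H_\gamma(\mathscr{D})$: the entry at $(u,v)$ is $1$ if $uv$ is a digon, $\gamma$ if there is an arc from $u$ to $v$, $\overline\gamma$ if there is an arc from $v$ to $u$, and $0$ otherwise. $\gamma$-incidence matrix $B^\gamma(\mathscr{D})$ (rows indexed by vertices, columns by edges): the entry at $(u,e)$ is $1$ if $e$ is a digon incident with $u$, $\gamma$ if $e$ is an arc with head $u$, $\overline\gamma$ if $e$ is an arc with tail $u$, and $0$ otherwise. $\gamma$-line graph $L_\gamma(\mathscr{D})$: the mixed orientation of the ordinary undirected line graph $L(\Gamma(\mathscr{D}))$ (vertices are the edges of $\mathscr{D}$, two being adjacent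 iff they share an endpoint) given as follows. For distinct edges $e,f$ sharing a vertex $v$: if $e$ is an arc with head $v$ and $f$ is an arc with tail $v$, there is an arc from $e$ to $f$; if $e,f$ are both arcs with head $v$, or both arcs with tail $v$, or both digons, then $ef$ is a digon; if $e$ is an arc with head $v$ and $f$ is a digon, there is an arc from $f$ to $e$; if $e$ is an arc with tail $v$ and $f$ is a digon, there is an arc from $e$ to $f$. -}

module Defs where

open import Level using (_⊔_; 0ℓ) renaming (suc to lsuc)
open import Algebra.Apartness.Bundles using (HeytingCommutativeRing; HeytingField)
open import Algebra.Bundles using (CommutativeRing)
open import Algebra.Bundles.Raw using (RawRing)
open import Algebra.Definitions.RawMonoid using (sum) renaming (_×_ to multiple)
open import Data.Bool.Base using (if_then_else_)
open import Data.Empty using (⊥; ⊥-elim)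
open import Data.Fin.Base as Fin using (Fin)
import Data.Fin.Properties as Fin
open import Data.List.Base using (List; allFin; cartesianProduct; filter; length; lookup)
open import Data.List.Membership.Propositional.Properties using (∈-lookup)
import Data.List.Relation.Unary.All as All
import Data.List.Relation.Unary.All.Properties as All
open import Data.List.Relation.Unary.AllPairs using (_∷_)
open import Data.List.Relation.Unary.Unique.Propositional using (Unique)
import Data.List.Relation.Unary.Unique.Propositional.Properties as Unique
open import Data.Nat.Base as ℕ using (ℕ)
open import Data.Product.Base using (∃-syntax; _×_; _,_; proj₁; proj₂)
open import Data.Sum.Base using (_⊎_; inj₁; inj₂)
open import Data.Vec.Functional using (Vector)
open import Function.Base using (_∘_)
open import Function.Bundles using (_⇔_; mk⇔; Equivalence)
open import Relation.Binary.Core using (Rel)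
open import Relation.Binary.Definitions using (Asymmetric; Decidable; Symmetric)
open import Relation.Binary.PropositionalEquality
  using (_≡_; _≢_; refl; sym; trans; cong; cong₂; subst₂)
open import Relation.Binary.Structures using (IsStrictPartialOrder)
open import Relation.Nullary.Decidable using (does; yes; no; _×-dec_; _⊎-dec_; ¬?)
open import Relation.Nullary.Negation using (¬_)

-- The real numbers, characterised as the Cauchy-complete Archimedean
-- ordered field.  The axioms are phrased so that both the classical and
-- the constructive reals are instances.

record RealNumbers c ℓ₁ ℓ₂ : Set (lsuc (c ⊔ ℓ₁ ⊔ ℓ₂)) where
  infix 4 _<_
  field
    heytingField : HeytingField c ℓ₁ ℓ₂

  open HeytingField heytingField public
  open HeytingCommutativeRing heytingCommutativeRing public using (commutativeRing)
  open CommutativeRing commutativeRing public using (+-rawMonoid)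

  field
    _<_                  : Rel Carrier ℓ₂
    isStrictPartialOrder : IsStrictPartialOrder _≈_ _<_
    #⇔<                  : ∀ x y → x # y ⇔ (x < y ⊎ y < x)
    0<1                  : 0# < 1#
    +-monoˡ-<            : ∀ {x y} z → x < y → x + z < y + z
    *-pos                : ∀ {x y} → 0# < x → 0# < y → 0# < x * y

  fromℕ : ℕ → Carrier
  fromℕ n = multiple +-rawMonoid n 1#

  IsCauchy : (ℕ → Carrier) → Set (c ⊔ ℓ₂)
  IsCauchy x = ∀ ε → 0# < ε →
    ∃[ N ] ∀ m n → N ℕ.≤ m → N ℕ.≤ n → x m - x n < ε

  _ConvergesTo_ : (ℕ → Carrier) → Carrier → Set (c ⊔ ℓ₂)
  x ConvergesTo l = ∀ ε → 0# < ε →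
    ∃[ N ] ∀ n → N ℕ.≤ n → (x n - l < ε × l - x n < ε)

  field
    archimedean : ∀ x → ∃[ n ] x < fromℕ n
    complete    : ∀ x → IsCauchy x → ∃[ l ] x ConvergesTo l

  module < = IsStrictPartialOrder isStrictPartialOrder

  0<2 : 0# < 1# + 1#
  0<2 = <.trans 0<1 (<.<-respˡ-≈ (+-identityˡ 1#) (+-monoˡ-< 1# 0<1))

  ½ : Carrier
  ½ = proj₁ (#⇒invertible (Equivalence.from (#⇔< (1# + 1#) 0#) (inj₂ 0<2)))

module ComplexNumbers {c ℓ₁ ℓ₂} (ℝ : RealNumbers c ℓ₁ ℓ₂) where
  private module ℝ = RealNumbers ℝ

  infix  4 _≈_
  infixl 6 _+_
  infixl 7 _*_

  -- (a , b) is a + b i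
  ℂ : Set c
  ℂ = ℝ.Carrier × ℝ.Carrier

  _≈_ : Rel ℂ ℓ₁
  (a , b) ≈ (a′ , b′) = a ℝ.≈ a′ × b ℝ.≈ b′

  _+_ _*_ : ℂ → ℂ → ℂ
  (a , b) + (a′ , b′) = a ℝ.+ a′ , b ℝ.+ b′
  (a , b) * (a′ , b′) = a ℝ.* a′ ℝ.- b ℝ.* b′ , a ℝ.* b′ ℝ.+ b ℝ.* a′

  -_ conj : ℂ → ℂ
  - (a , b)    = ℝ.- a , ℝ.- b
  conj (a , b) = a , ℝ.- b

  0ℂ 1ℂ : ℂ
  0ℂ = ℝ.0# , ℝ.0#
  1ℂ = ℝ.1# , ℝ.0#

  rawRing : RawRing c ℓ₁
  rawRing = record
    { _≈_ = _≈_ ; _+_ = _+_ ; _*_ = _*_ ; -_ = -_ ; 0# = 0ℂ ; 1# = 1ℂ }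

  open RawRing rawRing using (+-rawMonoid)

  fromℕ : ℕ → ℂ
  fromℕ n = multiple +-rawMonoid n 1ℂ

  -- e^{2πi/3} = cos (2π/3) + i sin (2π/3) = -1/2 + (√3/2) i
  e^2πi/3 : (√3 : ℝ.Carrier) → ℂ
  e^2πi/3 √3 = ℝ.- ℝ.½ , ℝ.½ ℝ.* √3

  Matrix : ℕ → ℕ → Set c
  Matrix m n = Vector (Vector ℂ n) m

  private variable
    k m n : ℕ

  infix  4 _≋_
  infixl 6 _⊕_
  infixl 7 _⊗_
  infixr 7 _·_
  infix  8 _ᴴ

  _≋_ : Rel (Matrix m n) ℓ₁
  M ≋ N = ∀ i j → M i j ≈ N i j

  _⊕_ : Matrix m n → Matrix m n → Matrix m n
  (M ⊕ N) i j = M i j + N i j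

  _⊗_ : Matrix m k → Matrix k n → Matrix m n
  (M ⊗ N) i j = sum +-rawMonoid λ l → M i l * N l j

  _·_ : ℂ → Matrix m n → Matrix m n
  (z · M) i j = z * M i j

  _ᴴ : Matrix m n → Matrix n m
  (M ᴴ) i j = conj (M j i)

  diag : Vector ℂ n → Matrix n n
  diag d i j = if does (i Fin.≟ j) then d i else 0ℂ

  I : Matrix n n
  I = diag λ _ → 1ℂ

record Graph (n : ℕ) : Set₁ where
  infix 4 _~_
  field
    _~_    : Rel (Fin n) 0ℓ
    _~?_   : Decidable _~_
    symm   : Symmetric _~_
    irrefl : ∀ {v} → ¬ v ~ v

  deg : Fin n → ℕ
  deg v = length (filter (v ~?_) (allFin n))

  -- The edge {x , y} is listed once, as the pair with x < y.
  edges : List (Fin n × Fin n)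
  edges = filter (λ (x , y) → (x Fin.<? y) ×-dec (x ~? y))
                 (cartesianProduct (allFin n) (allFin n))

  Edge : Set
  Edge = Fin (length edges)

  end₁ end₂ : Edge → Fin n
  end₁ e = proj₁ (lookup edges e)
  end₂ e = proj₂ (lookup edges e)

  Incident : Fin n → Edge → Set
  Incident v e = v ≡ end₁ e ⊎ v ≡ end₂ e

  incident? : Decidable Incident
  incident? v e = (v Fin.≟ end₁ e) ⊎-dec (v Fin.≟ end₂ e)

  Adjacent : Rel Edge 0ℓ
  Adjacent e f = e ≢ f × ∃[ v ] (Incident v e × Incident v f)

  lineGraph : Graph (length edges)
  lineGraph = record
    { _~_    = Adjacent
    ; _~?_   = λ e f → ¬? (e Fin.≟ f) ×-dec
                       Fin.any? λ v → incident? v e ×-dec incident? v f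
    ; symm   = λ (e≢f , v , v∈e , v∈f) → e≢f ∘ sym , v , v∈f , v∈e
    ; irrefl = λ (e≢e , _) → e≢e refl
    }

  end₁<end₂ : ∀ e → end₁ e Fin.< end₂ e
  end₁<end₂ e = proj₁ (All.lookup (All.all-filter _ (cartesianProduct (allFin n) (allFin n)))
                                  (∈-lookup {xs = edges} e))

  ends-~ : ∀ e → end₁ e ~ end₂ e
  ends-~ e = proj₂ (All.lookup (All.all-filter _ (cartesianProduct (allFin n) (allFin n)))
                               (∈-lookup {xs = edges} e))

  ends-injective : ∀ {e f} → end₁ e ≡ end₁ f → end₂ e ≡ end₂ f → e ≡ f
  ends-injective {e} {f} p q = lookup-injective edges-unique e f (cong₂ _,_ p q)
    where
    edges-unique : Unique edges
    edges-unique = Unique.filter⁺ _ (Unique.cartesianProduct⁺ (Unique.allFin⁺ n) (Unique.allFin⁺ n))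

    lookup-injective : ∀ {xs : List (Fin n × Fin n)} → Unique xs →
                       ∀ i j → lookup xs i ≡ lookup xs j → i ≡ j
    lookup-injective (_ ∷ _)  Fin.zero    Fin.zero    _  = refl
    lookup-injective (x∉ ∷ _) Fin.zero    (Fin.suc j) eq = ⊥-elim (All.lookup x∉ (∈-lookup j) eq)
    lookup-injective (x∉ ∷ _) (Fin.suc i) Fin.zero    eq = ⊥-elim (All.lookup x∉ (∈-lookup i) (sym eq))
    lookup-injective (_ ∷ u)  (Fin.suc i) (Fin.suc j) eq = cong Fin.suc (lookup-injective u i j eq)

  ¬crossed : ∀ e f → end₁ e ≡ end₂ f → end₂ e ≢ end₁ f
  ¬crossed e f p q = Fin.<-asym (end₁<end₂ e)
    (subst₂ Fin._<_ (sym q) (sym p) (end₁<end₂ f))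

  shared-vertex-unique : ∀ {e f u v} → e ≢ f →
    Incident u e → Incident u f → Incident v e → Incident v f → u ≡ v
  shared-vertex-unique e≢f (inj₁ p) _ (inj₁ q) _ = trans p (sym q)
  shared-vertex-unique e≢f (inj₂ p) _ (inj₂ q) _ = trans p (sym q)
  shared-vertex-unique e≢f (inj₁ _) (inj₁ p) (inj₂ _) (inj₁ q) = trans p (sym q)
  shared-vertex-unique e≢f (inj₁ _) (inj₂ p) (inj₂ _) (inj₂ q) = trans p (sym q)
  shared-vertex-unique e≢f (inj₂ _) (inj₁ p) (inj₁ _) (inj₁ q) = trans p (sym q)
  shared-vertex-unique e≢f (inj₂ _) (inj₂ p) (inj₁ _) (inj₂ q) = trans p (sym q)
  shared-vertex-unique e≢f (inj₁ refl) (inj₁ p) (inj₂ refl) (inj₂ q) = ⊥-elim (e≢f (ends-injective p q))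
  shared-vertex-unique e≢f (inj₂ refl) (inj₂ q) (inj₁ refl) (inj₁ p) = ⊥-elim (e≢f (ends-injective p q))
  shared-vertex-unique {e} {f} _ (inj₁ refl) (inj₂ p) (inj₂ refl) (inj₁ q) = ⊥-elim (¬crossed e f p q)
  shared-vertex-unique {e} {f} _ (inj₂ refl) (inj₁ q) (inj₁ refl) (inj₂ p) = ⊥-elim (¬crossed e f p q)

record MixedGraph (n : ℕ) : Set₁ where
  infix 4 _⇒_
  field
    Γ    : Graph n
    _⇒_  : Rel (Fin n) 0ℓ
    _⇒?_ : Decidable _⇒_
    ⇒-~  : ∀ {u v} → u ⇒ v → Graph._~_ Γ u v
    asym : Asymmetric _⇒_

  open Graph Γ public

  Digon : Rel (Fin n) 0ℓ
  Digon u v = u ~ v × ¬ u ⇒ v × ¬ v ⇒ u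

  digon? : Decidable Digon
  digon? u v = (u ~? v) ×-dec ¬? (u ⇒? v) ×-dec ¬? (v ⇒? u)

  Head Tail : Fin n → Edge → Set
  Head v e = (v ≡ end₂ e × end₁ e ⇒ end₂ e) ⊎ (v ≡ end₁ e × end₂ e ⇒ end₁ e)
  Tail v e = (v ≡ end₁ e × end₁ e ⇒ end₂ e) ⊎ (v ≡ end₂ e × end₂ e ⇒ end₁ e)

  DigonAt : Fin n → Edge → Set
  DigonAt v e = Incident v e × Digon (end₁ e) (end₂ e)

  head? : Decidable Head
  head? v e = ((v Fin.≟ end₂ e) ×-dec (end₁ e ⇒? end₂ e)) ⊎-dec
              ((v Fin.≟ end₁ e) ×-dec (end₂ e ⇒? end₁ e))

  tail? : Decidable Tail
  tail? v e = ((v Fin.≟ end₁ e) ×-dec (end₁ e ⇒? end₂ e)) ⊎-dec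
              ((v Fin.≟ end₂ e) ×-dec (end₂ e ⇒? end₁ e))

  digonAt? : Decidable DigonAt
  digonAt? v e = incident? v e ×-dec digon? (end₁ e) (end₂ e)

  head-incident : ∀ {v e} → Head v e → Incident v e
  head-incident (inj₁ (p , _)) = inj₂ p
  head-incident (inj₂ (p , _)) = inj₁ p

  tail-incident : ∀ {v e} → Tail v e → Incident v e
  tail-incident (inj₁ (p , _)) = inj₁ p
  tail-incident (inj₂ (p , _)) = inj₂ p

  ¬head×tail : ∀ {v e} → Head v e → Tail v e → ⊥
  ¬head×tail {e = e} (inj₁ (refl , _)) (inj₁ (q , _)) = Fin.<-irrefl (sym q) (end₁<end₂ e)
  ¬head×tail         (inj₁ (_ , a))    (inj₂ (_ , b)) = asym a b
  ¬head×tail         (inj₂ (_ , a))    (inj₁ (_ , b)) = asym a b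
  ¬head×tail {e = e} (inj₂ (refl , _)) (inj₂ (q , _)) = Fin.<-irrefl q (end₁<end₂ e)

  ¬head×digon : ∀ {u v e} → Head u e → DigonAt v e → ⊥
  ¬head×digon (inj₁ (_ , a)) (_ , _ , ¬a , _) = ¬a a
  ¬head×digon (inj₂ (_ , a)) (_ , _ , _ , ¬a) = ¬a a

  ¬tail×digon : ∀ {u v e} → Tail u e → DigonAt v e → ⊥
  ¬tail×digon (inj₁ (_ , a)) (_ , _ , ¬a , _) = ¬a a
  ¬tail×digon (inj₂ (_ , a)) (_ , _ , _ , ¬a) = ¬a a

  incident-cases : ∀ {v e} → Incident v e → Head v e ⊎ Tail v e ⊎ DigonAt v e
  incident-cases {v} {e} i with end₁ e ⇒? end₂ e | end₂ e ⇒? end₁ e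
  incident-cases (inj₁ p) | yes a | _     = inj₂ (inj₁ (inj₁ (p , a)))
  incident-cases (inj₂ p) | yes a | _     = inj₁ (inj₁ (p , a))
  incident-cases (inj₁ p) | no _  | yes b = inj₁ (inj₂ (p , b))
  incident-cases (inj₂ p) | no _  | yes b = inj₂ (inj₁ (inj₂ (p , b)))
  incident-cases {e = e} i | no ¬a | no ¬b = inj₂ (inj₂ (i , ends-~ e , ¬a , ¬b))

  ArcAt DigonLineAt : Fin n → Rel Edge 0ℓ
  ArcAt v e f = (Head v e × Tail v f)
              ⊎ (DigonAt v e × Head v f)
              ⊎ (Tail v e × DigonAt v f)
  DigonLineAt v e f = (Head v e × Head v f)
                    ⊎ (Tail v e × Tail v f)
                    ⊎ (DigonAt v e × DigonAt v f)

  arcAt⇒incident : ∀ {v e f} → ArcAt v e f → Incident v e × Incident v f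
  arcAt⇒incident (inj₁ (h , t))        = head-incident h , tail-incident t
  arcAt⇒incident (inj₂ (inj₁ (d , h))) = proj₁ d , head-incident h
  arcAt⇒incident (inj₂ (inj₂ (t , d))) = tail-incident t , proj₁ d

  arcAt-asym : ∀ {v e f} → ArcAt v e f → ArcAt v f e → ⊥
  arcAt-asym (inj₁ (h , _))        (inj₁ (_ , t))        = ¬head×tail h t
  arcAt-asym (inj₁ (_ , t))        (inj₂ (inj₁ (d , _))) = ¬tail×digon t d
  arcAt-asym (inj₁ (h , _))        (inj₂ (inj₂ (_ , d))) = ¬head×digon h d
  arcAt-asym (inj₂ (inj₁ (d , _))) (inj₁ (_ , t))        = ¬tail×digon t d
  arcAt-asym (inj₂ (inj₁ (_ , h))) (inj₂ (inj₁ (d , _))) = ¬head×digon h d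
  arcAt-asym (inj₂ (inj₁ (_ , h))) (inj₂ (inj₂ (t , _))) = ¬head×tail h t
  arcAt-asym (inj₂ (inj₂ (_ , d))) (inj₁ (h , _))        = ¬head×digon h d
  arcAt-asym (inj₂ (inj₂ (t , _))) (inj₂ (inj₁ (_ , h))) = ¬head×tail h t
  arcAt-asym (inj₂ (inj₂ (t , _))) (inj₂ (inj₂ (_ , d))) = ¬tail×digon t d

-- The digons of L D are the adjacent pairs carrying no arc in either
-- direction; by lineDigon⇔ these are the pairs whose shared vertex is a head
-- of both edges, a tail of both, or lies on two digons.

L : ∀ {n} (D : MixedGraph n) → MixedGraph (length (MixedGraph.edges D))
L {n} D = record
  { Γ    = lineGraph
  ; _⇒_  = λ e f → e ≢ f × ∃[ v ] ArcAt v e f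
  ; _⇒?_ = λ e f → ¬? (e Fin.≟ f) ×-dec Fin.any? λ v →
             (head? v e ×-dec tail? v f)
             ⊎-dec (digonAt? v e ×-dec head? v f)
             ⊎-dec (tail? v e ×-dec digonAt? v f)
  ; ⇒-~  = λ (e≢f , v , a) → e≢f , v , arcAt⇒incident a
  ; asym = line-asym
  }
  where
  open MixedGraph D
  line-asym : Asymmetric (λ e f → e ≢ f × ∃[ v ] ArcAt v e f)
  line-asym (e≢f , u , a) (_ , v , b)
    with arcAt⇒incident a | arcAt⇒incident b
  ... | u∈e , u∈f | v∈f , v∈e
    with refl ← shared-vertex-unique e≢f u∈e u∈f v∈e v∈f = arcAt-asym a b

lineDigon⇔ : ∀ {n} (D : MixedGraph n) → let open MixedGraph D in
  ∀ e f → MixedGraph.Digon (L D) e f ⇔ (e ≢ f × ∃[ v ] DigonLineAt v e f)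
lineDigon⇔ D e f = mk⇔ to from
  where
  open MixedGraph D
  to : MixedGraph.Digon (L D) e f → e ≢ f × ∃[ v ] DigonLineAt v e f
  to ((e≢f , v , v∈e , v∈f) , ¬ef , ¬fe)
    with incident-cases {v} {e} v∈e | incident-cases {v} {f} v∈f
  ... | inj₁ h        | inj₁ h′        = e≢f , v , inj₁ (h , h′)
  ... | inj₁ h        | inj₂ (inj₁ t)  = ⊥-elim (¬ef (e≢f , v , inj₁ (h , t)))
  ... | inj₁ h        | inj₂ (inj₂ d)  = ⊥-elim (¬fe (e≢f ∘ sym , v , inj₂ (inj₁ (d , h))))
  ... | inj₂ (inj₁ t) | inj₁ h         = ⊥-elim (¬fe (e≢f ∘ sym , v , inj₁ (h , t)))
  ... | inj₂ (inj₁ t) | inj₂ (inj₁ t′) = e≢f , v , inj₂ (inj₁ (t , t′))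
  ... | inj₂ (inj₁ t) | inj₂ (inj₂ d)  = ⊥-elim (¬ef (e≢f , v , inj₂ (inj₂ (t , d))))
  ... | inj₂ (inj₂ d) | inj₁ h         = ⊥-elim (¬ef (e≢f , v , inj₂ (inj₁ (d , h))))
  ... | inj₂ (inj₂ d) | inj₂ (inj₁ t)  = ⊥-elim (¬fe (e≢f ∘ sym , v , inj₂ (inj₂ (t , d))))
  ... | inj₂ (inj₂ d) | inj₂ (inj₂ d′) = e≢f , v , inj₂ (inj₂ (d , d′))

  incident : ∀ {v} → DigonLineAt v e f → Incident v e × Incident v f
  incident (inj₁ (h , h′))        = head-incident h , head-incident h′
  incident (inj₂ (inj₁ (t , t′))) = tail-incident t , tail-incident t′
  incident (inj₂ (inj₂ (d , d′))) = proj₁ d , proj₁ d′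

  exclusive : ∀ {v} → DigonLineAt v e f → ¬ ArcAt v e f × ¬ ArcAt v f e
  exclusive (inj₁ (h , h′)) =
    (λ { (inj₁ (_ , t))        → ¬head×tail h′ t
       ; (inj₂ (inj₁ (d , _))) → ¬head×digon h d
       ; (inj₂ (inj₂ (t , _))) → ¬head×tail h t }) ,
    (λ { (inj₁ (_ , t))        → ¬head×tail h t
       ; (inj₂ (inj₁ (d , _))) → ¬head×digon h′ d
       ; (inj₂ (inj₂ (t , _))) → ¬head×tail h′ t })
  exclusive (inj₂ (inj₁ (t , t′))) =
    (λ { (inj₁ (h , _))        → ¬head×tail h t
       ; (inj₂ (inj₁ (_ , h))) → ¬head×tail h t′
       ; (inj₂ (inj₂ (_ , d))) → ¬tail×digon t′ d }) ,
    (λ { (inj₁ (h , _))        → ¬head×tail h t′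
       ; (inj₂ (inj₁ (_ , h))) → ¬head×tail h t
       ; (inj₂ (inj₂ (_ , d))) → ¬tail×digon t d })
  exclusive (inj₂ (inj₂ (d , d′))) =
    (λ { (inj₁ (h , _))        → ¬head×digon h d
       ; (inj₂ (inj₁ (_ , h))) → ¬head×digon h d′
       ; (inj₂ (inj₂ (t , _))) → ¬tail×digon t d }) ,
    (λ { (inj₁ (h , _))        → ¬head×digon h d′
       ; (inj₂ (inj₁ (_ , h))) → ¬head×digon h d
       ; (inj₂ (inj₂ (t , _))) → ¬tail×digon t d′ })

  from : e ≢ f × ∃[ v ] DigonLineAt v e f → MixedGraph.Digon (L D) e f
  from (e≢f , v , x) with incident x
  ... | v∈e , v∈f = (e≢f , v , v∈e , v∈f) , ¬ef , ¬fe
    where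
    ¬ef : ¬ (e ≢ f × ∃[ u ] ArcAt u e f)
    ¬ef (_ , u , a) with arcAt⇒incident a
    ... | u∈e , u∈f with refl ← shared-vertex-unique e≢f u∈e u∈f v∈e v∈f = proj₁ (exclusive x) a
    ¬fe : ¬ (f ≢ e × ∃[ u ] ArcAt u f e)
    ¬fe (_ , u , a) with arcAt⇒incident a
    ... | u∈f , u∈e with refl ← shared-vertex-unique e≢f u∈e u∈f v∈e v∈f = proj₂ (exclusive x) a

module GraphMatrices {c ℓ₁ ℓ₂} (ℝ : RealNumbers c ℓ₁ ℓ₂) where
  open ComplexNumbers ℝ
  open MixedGraph

  H : ∀ {n} → ℂ → MixedGraph n → Matrix n n
  H γ D u v =
    if      does (digon? D u v) then 1ℂ
    else if does (_⇒?_ D u v)   then γ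
    else if does (_⇒?_ D v u)   then conj γ
    else 0ℂ

  B : ∀ {n} → ℂ → (D : MixedGraph n) → Matrix n (length (edges D))
  B γ D u e =
    if      does (digonAt? D u e) then 1ℂ
    else if does (head? D u e)    then γ
    else if does (tail? D u e)    then conj γ
    else 0ℂ

  degreeMatrix : ∀ {n} → MixedGraph n → Matrix n n
  degreeMatrix D = diag λ v → fromℕ (deg D v)

-- The nonzero entries of H_γ and B^γ are cube roots of unity.  If uv is an
-- edge and r = H_γ(u , v), then B^γ has the entries r⁻¹ at u and r at v, and
-- r⁻¹ · conj r = r⁻² = r since r³ = 1.  If distinct edges e and f meet at v,
-- with entries r and s of B^γ there, then the rules for L_γ amount to
-- H_γ(e , f) = r⁻¹ · s.  Off the diagonal each sum has at most one nonzero
-- term, as two vertices share at most one edge and two edges at most one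
-- vertex.  On the diagonal every nonzero term is 1, so B B* counts the edges
-- at a vertex and B* B the ends of an edge.

module Submission where

open import Defs
open import Algebra.Bundles using (CommutativeMonoid; CommutativeRing)
import Algebra.Construct.DirectProduct as DirectProduct
import Algebra.Properties.CommutativeMonoid.Sum as CommutativeMonoidSum
import Algebra.Properties.Ring as RingProperties
open import Data.Bool.Base using (if_then_else_)
open import Data.Empty using (⊥-elim)
open import Data.Fin.Base as Fin using (Fin; zero; suc)
import Data.Fin.Properties as Fin
open import Data.List.Base using (filter; length; tabulate)
open import Data.List.Membership.Propositional using (_∈_)
open import Data.List.Membership.Propositional.Properties
  using (∈-allFin; ∈-cartesianProduct⁺; ∈-filter⁺)
open import Data.List.Relation.Unary.Any using (index)
open import Data.List.Relation.Unary.Any.Properties using (lookup-index)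
open import Data.Nat.Base using (ℕ; zero; suc)
open import Data.Product.Base using (_×_; _,_; proj₁; proj₂; ∃; ∃-syntax)
open import Data.Sum.Base using (_⊎_; inj₁; inj₂)
open import Data.Vec.Functional using (Vector; removeAt)
open import Function.Base using (_∘_)
open import Function.Bundles using (Equivalence)
open import Level using (Level)
open import Relation.Binary.Definitions using (tri<; tri≈; tri>)
open import Relation.Binary.PropositionalEquality as ≡ using (_≡_; _≢_)
import Relation.Binary.Reasoning.Setoid as SetoidReasoning
open import Relation.Nullary.Decidable using (Dec; does; yes; no; _×-dec_; _⊎-dec_)
open import Relation.Nullary.Negation using (¬_; contradiction)

private variable
  a p q : Level

if-yes : {A : Set a} {P : Set p} {x y : A} (P? : Dec P) → P →
         (if does P? then x else y) ≡ x
if-yes (yes _) _ = ≡.refl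
if-yes (no ¬p) p = contradiction p ¬p

if-no : {A : Set a} {P : Set p} {x y : A} (P? : Dec P) → ¬ P →
        (if does P? then x else y) ≡ y
if-no (yes p) ¬p = contradiction p ¬p
if-no (no _)  _  = ≡.refl

-- Symbolic cube roots of unity, interpreted by ⟦_⟧ as 1, γ and conj γ.

data Root : Set where
  one ω ω² : Root

infixl 7 _∙_

_∙_ : Root → Root → Root
one ∙ s   = s
ω   ∙ one = ω
ω   ∙ ω   = ω²
ω   ∙ ω²  = one
ω²  ∙ one = ω²
ω²  ∙ ω   = one
ω²  ∙ ω²  = ω

inv : Root → Root
inv one = one
inv ω   = ω²
inv ω²  = ω

∙-inverseʳ : ∀ r → r ∙ inv r ≡ one
∙-inverseʳ one = ≡.refl
∙-inverseʳ ω   = ≡.refl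
∙-inverseʳ ω²  = ≡.refl

-- Inverting twice over gives r⁻² = r, since r³ = 1. This is where identity (ii) depends on `γ`
-- being a third root of unity rather than an arbitrary unit.
inv∙inv : ∀ r → inv r ∙ inv r ≡ r
inv∙inv one = ≡.refl
inv∙inv ω   = ≡.refl
inv∙inv ω²  = ≡.refl

inv-involutive : ∀ r → inv (inv r) ≡ r
inv-involutive one = ≡.refl
inv-involutive ω   = ≡.refl
inv-involutive ω²  = ≡.refl

-- Edges, their ends and their orientation in a mixed graph.

module Combinatorics {n} (D : MixedGraph n) where
  open MixedGraph D

  -- Phase u v r and Role v e r say that r is the entry of H_γ at (u , v) and
  -- of B^γ at (v , e).

  Phase : Fin n → Fin n → Root → Set
  Phase u v one = Digon u v
  Phase u v ω   = u ⇒ v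
  Phase u v ω²  = v ⇒ u

  Role : Fin n → Edge → Root → Set
  Role v e one = DigonAt v e
  Role v e ω   = Head v e
  Role v e ω²  = Tail v e

  role : ∀ {v e} → Incident v e → ∃ (Role v e)
  role i with incident-cases i
  ... | inj₁ h        = ω , h
  ... | inj₂ (inj₁ t) = ω² , t
  ... | inj₂ (inj₂ d) = one , d

  phase : ∀ {u v} → u ~ v → ∃ (Phase u v)
  phase {u} {v} u~v with u ⇒? v | v ⇒? u
  ... | yes a | _     = ω , a
  ... | no _  | yes b = ω² , b
  ... | no ¬a | no ¬b = one , u~v , ¬a , ¬b

  -- The Hermitian symmetry of H_γ: conjugating a root of unity inverts it.
  phase-inv : ∀ {u v} r → Phase u v r → Phase v u (inv r)
  phase-inv one (u~v , ¬a , ¬b) = symm u~v , ¬b , ¬a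
  phase-inv ω   a               = a
  phase-inv ω²  a               = a

  -- A phase `ω` is an arc leaving the first end, and a tail carries `ω²`; hence the inverse here,
  -- and none at the second end in `role₂`.
  role₁ : ∀ {e} r → Phase (end₁ e) (end₂ e) r → Role (end₁ e) e (inv r)
  role₁ one d = inj₁ ≡.refl , d
  role₁ ω   a = inj₁ (≡.refl , a)
  role₁ ω²  a = inj₂ (≡.refl , a)

  role₂ : ∀ {e} r → Phase (end₁ e) (end₂ e) r → Role (end₂ e) e r
  role₂ one d = inj₂ ≡.refl , d
  role₂ ω   a = inj₁ (≡.refl , a)
  role₂ ω²  a = inj₂ (≡.refl , a)

  -- An edge is listed only as an increasing pair, while matrix entries are indexed by ordered pairs
  -- (u , v), so both orders must be allowed.
  Joins : Fin n → Fin n → Edge → Set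
  Joins u v e = (u ≡ end₁ e × v ≡ end₂ e) ⊎ (u ≡ end₂ e × v ≡ end₁ e)

  joins? : ∀ u v e → Dec (Joins u v e)
  joins? u v e = ((u Fin.≟ end₁ e) ×-dec (v Fin.≟ end₂ e)) ⊎-dec
                 ((u Fin.≟ end₂ e) ×-dec (v Fin.≟ end₁ e))

  end₁≢end₂ : ∀ e → end₁ e ≢ end₂ e
  end₁≢end₂ e eq = Fin.<-irrefl eq (end₁<end₂ e)

  incident×incident⇒joins : ∀ {u v e} → u ≢ v → Incident u e → Incident v e → Joins u v e
  incident×incident⇒joins u≢v (inj₁ p) (inj₁ q) = ⊥-elim (u≢v (≡.trans p (≡.sym q)))
  incident×incident⇒joins u≢v (inj₁ p) (inj₂ q) = inj₁ (p , q)
  incident×incident⇒joins u≢v (inj₂ p) (inj₁ q) = inj₂ (p , q)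
  incident×incident⇒joins u≢v (inj₂ p) (inj₂ q) = ⊥-elim (u≢v (≡.trans p (≡.sym q)))

  joins⇒incident : ∀ {u v e} → Joins u v e → Incident u e
  joins⇒incident (inj₁ (p , _)) = inj₁ p
  joins⇒incident (inj₂ (p , _)) = inj₂ p

  incident⇒joins : ∀ {u e} → Incident u e → ∃[ v ] Joins u v e
  incident⇒joins (inj₁ p) = _ , inj₁ (p , ≡.refl)
  incident⇒joins (inj₂ p) = _ , inj₂ (p , ≡.refl)

  joins⇒~ : ∀ {u v e} → Joins u v e → u ~ v
  joins⇒~ {e = e} (inj₁ (≡.refl , ≡.refl)) = ends-~ e
  joins⇒~ {e = e} (inj₂ (≡.refl , ≡.refl)) = symm (ends-~ e)

  -- The order of `u` and `v` decides which of the two pairs occurs in `edges`; its index there is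
  -- the edge sought.
  ~⇒joins : ∀ {u v} → u ~ v → ∃[ e ] Joins u v e
  ~⇒joins {u} {v} u~v with Fin.<-cmp u v
  ... | tri< u<v _ _ = index ∈edges ,
    inj₁ (≡.cong proj₁ (lookup-index ∈edges) , ≡.cong proj₂ (lookup-index ∈edges))
    where
    ∈edges : (u , v) ∈ edges
    ∈edges = ∈-filter⁺ _ (∈-cartesianProduct⁺ (∈-allFin u) (∈-allFin v)) (u<v , u~v)
  ... | tri≈ _ ≡.refl _ = ⊥-elim (irrefl u~v)
  ... | tri> _ _ v<u = index ∈edges ,
    inj₂ (≡.cong proj₂ (lookup-index ∈edges) , ≡.cong proj₁ (lookup-index ∈edges))
    where
    ∈edges : (v , u) ∈ edges
    ∈edges = ∈-filter⁺ _ (∈-cartesianProduct⁺ (∈-allFin v) (∈-allFin u)) (v<u , symm u~v)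

  -- The underlying graph is simple. Two edges joining the vertices in opposite orders would
  -- contradict `end₁` < `end₂`, by `¬crossed`.
  joins-injective : ∀ {u v e f} → Joins u v e → Joins u v f → e ≡ f
  joins-injective (inj₁ (p , q)) (inj₁ (p′ , q′)) =
    ends-injective (≡.trans (≡.sym p) p′) (≡.trans (≡.sym q) q′)
  joins-injective {e = e} {f} (inj₁ (p , q)) (inj₂ (p′ , q′)) =
    ⊥-elim (¬crossed e f (≡.trans (≡.sym p) p′) (≡.trans (≡.sym q) q′))
  joins-injective {e = e} {f} (inj₂ (p , q)) (inj₁ (p′ , q′)) =
    ⊥-elim (¬crossed e f (≡.trans (≡.sym q) q′) (≡.trans (≡.sym p) p′))
  joins-injective (inj₂ (p , q)) (inj₂ (p′ , q′)) =
    ends-injective (≡.trans (≡.sym q) q′) (≡.trans (≡.sym p) p′)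

  joins-functional : ∀ {u v w e} → Joins u v e → Joins u w e → v ≡ w
  joins-functional         (inj₁ (p , q)) (inj₁ (p′ , q′)) = ≡.trans q (≡.sym q′)
  joins-functional {e = e} (inj₁ (p , q)) (inj₂ (p′ , q′)) = ⊥-elim (end₁≢end₂ e (≡.trans (≡.sym p) p′))
  joins-functional {e = e} (inj₂ (p , q)) (inj₁ (p′ , q′)) = ⊥-elim (end₁≢end₂ e (≡.trans (≡.sym p′) p))
  joins-functional         (inj₂ (p , q)) (inj₂ (p′ , q′)) = ≡.trans q (≡.sym q′)

  -- Along the listed order this is `role₁` and `role₂`. Against it the two ends swap and the root
  -- becomes its inverse, so the entry at `u` has to be read as a double inverse.
  joins-phase : ∀ {u v e} → Joins u v e →
    ∃[ r ] Role u e (inv r) × Role v e r × Phase u v r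
  joins-phase {e = e} (inj₁ (≡.refl , ≡.refl)) with r , ph ← phase (ends-~ e) =
    r , role₁ r ph , role₂ r ph , ph
  joins-phase {e = e} (inj₂ (≡.refl , ≡.refl)) with r , ph ← phase (ends-~ e) =
    inv r , ≡.subst (Role _ e) (≡.sym (inv-involutive r)) (role₂ r ph) , role₁ r ph ,
    phase-inv r ph

-- The orientation rules of the line graph as a quotient of roots.

module LineGraph {n} (D : MixedGraph n) where
  open MixedGraph D
  open Combinatorics D
  open Combinatorics (L D) using () renaming (Phase to LinePhase)

  -- The nine pairs of roles match the rules for L_γ one by one. Equal roles have quotient `one` and
  -- give a digon, a quotient `ω` is an arc from `e` to `f`, and a quotient `ω²` is an arc from `f`
  -- to `e`.
  line-phase : ∀ {v e f} r s → e ≢ f → Role v e r → Role v f s → LinePhase e f (inv r ∙ s)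
  line-phase {v} {e} {f} = go
    where
    digon : e ≢ f → DigonLineAt v e f → MixedGraph.Digon (L D) e f
    digon e≢f d = Equivalence.from (lineDigon⇔ D e f) (e≢f , v , d)

    go : ∀ r s → e ≢ f → Role v e r → Role v f s → LinePhase e f (inv r ∙ s)
    go one one e≢f x y = digon e≢f (inj₂ (inj₂ (x , y)))
    go one ω   e≢f x y = e≢f , v , inj₂ (inj₁ (x , y))
    go one ω²  e≢f x y = e≢f ∘ ≡.sym , v , inj₂ (inj₂ (y , x))
    go ω   one e≢f x y = e≢f ∘ ≡.sym , v , inj₂ (inj₁ (y , x))
    go ω   ω   e≢f x y = digon e≢f (inj₁ (x , y))
    go ω   ω²  e≢f x y = e≢f , v , inj₁ (x , y)
    go ω²  one e≢f x y = e≢f , v , inj₂ (inj₂ (x , y))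
    go ω²  ω   e≢f x y = e≢f ∘ ≡.sym , v , inj₁ (y , x)
    go ω²  ω²  e≢f x y = digon e≢f (inj₂ (inj₁ (x , y)))

-- Complex arithmetic, finite sums and counting.

module ComplexProperties {c ℓ₁ ℓ₂} (ℝ : RealNumbers c ℓ₁ ℓ₂) where
  private module ℝ = RealNumbers ℝ
  open ComplexNumbers ℝ
  private
    module R where
      open CommutativeRing ℝ.commutativeRing public
      open RingProperties ring public

  -- Complex addition is componentwise, so a direct product of two copies of the real additive
  -- monoid makes the general lemmas on finite sums apply to the sums in `_⊗_`.
  +-commutativeMonoid = DirectProduct.commutativeMonoid R.+-commutativeMonoid R.+-commutativeMonoid

  open CommutativeMonoid +-commutativeMonoid public
    using (setoid; refl; sym; trans; reflexive)
    renaming ( ∙-cong to +-cong; ∙-congˡ to +-congˡ; ∙-congʳ to +-congʳ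
             ; identityˡ to +-identityˡ; identityʳ to +-identityʳ )
  open CommutativeMonoidSum +-commutativeMonoid public
    using (sum; sum-cong-≋; sum-remove; sum-replicate-zero; ∑-distrib-+; ∑-comm)

  *-cong : ∀ {w x y z} → w ≈ x → y ≈ z → w * y ≈ x * z
  *-cong (p , p′) (q , q′) =
    R.+-cong (R.*-cong p q) (R.-‿cong (R.*-cong p′ q′)) ,
    R.+-cong (R.*-cong p q′) (R.*-cong p′ q)

  *-comm : ∀ x y → x * y ≈ y * x
  *-comm (a , b) (c , d) =
    R.+-cong (R.*-comm a c) (R.-‿cong (R.*-comm b d)) ,
    R.trans (R.+-comm (a R.* d) (b R.* c)) (R.+-cong (R.*-comm b c) (R.*-comm a d))

  *-identityˡ : ∀ x → 1ℂ * x ≈ x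
  *-identityˡ (a , b) =
    R.trans (R.+-cong (R.*-identityˡ a) (R.trans (R.-‿cong (R.zeroˡ b)) R.-0#≈0#)) (R.+-identityʳ a) ,
    R.trans (R.+-cong (R.*-identityˡ b) (R.zeroˡ a)) (R.+-identityʳ b)

  *-identityʳ : ∀ x → x * 1ℂ ≈ x
  *-identityʳ x = trans (*-comm x 1ℂ) (*-identityˡ x)

  *-zeroˡ : ∀ x → 0ℂ * x ≈ 0ℂ
  *-zeroˡ (a , b) =
    R.trans (R.+-cong (R.zeroˡ a) (R.trans (R.-‿cong (R.zeroˡ b)) R.-0#≈0#)) (R.+-identityʳ R.0#) ,
    R.trans (R.+-cong (R.zeroˡ b) (R.zeroˡ a)) (R.+-identityʳ R.0#)

  *-zeroʳ : ∀ x → x * 0ℂ ≈ 0ℂ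
  *-zeroʳ x = trans (*-comm x 0ℂ) (*-zeroˡ x)

  conj-cong : ∀ {x y} → x ≈ y → conj x ≈ conj y
  conj-cong (p , q) = p , R.-‿cong q

  conj-involutive : ∀ x → conj (conj x) ≈ x
  conj-involutive (a , b) = R.refl , R.-‿involutive b

  conj-0 : conj 0ℂ ≈ 0ℂ
  conj-0 = R.refl , R.-0#≈0#

  conj-1 : conj 1ℂ ≈ 1ℂ
  conj-1 = R.refl , R.-0#≈0#

  -- Reduces the square of `conj γ` to the square of `γ`.
  conj-* : ∀ x y → conj x * conj y ≈ conj (x * y)
  conj-* (a , b) (c , d) =
    R.+-congˡ (R.-‿cong (neg-neg b d)) ,
    R.trans (R.+-cong (R.sym (R.-‿distribʳ-* a d)) (R.sym (R.-‿distribˡ-* b c)))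
            (R.-‿+-comm (a R.* d) (b R.* c))
    where
    neg-neg : ∀ x y → R.- x R.* R.- y R.≈ x R.* y
    neg-neg x y = R.trans (R.sym (R.-‿distribˡ-* x (R.- y)))
      (R.trans (R.-‿cong (R.sym (R.-‿distribʳ-* x y))) (R.-‿involutive (x R.* y)))

  sum-zero : ∀ {n} {t : Vector ℂ n} → (∀ i → t i ≈ 0ℂ) → sum t ≈ 0ℂ
  sum-zero {n} t≈0 = trans (sum-cong-≋ t≈0) (sum-replicate-zero n)

  sum-single : ∀ {n} {t : Vector ℂ n} i → (∀ j → j ≢ i → t j ≈ 0ℂ) → sum t ≈ t i
  sum-single {suc n} {t} i t≈0 = begin
    sum t                      ≈⟨ sum-remove {i = i} t ⟩
    t i + sum (removeAt t i)   ≈⟨ +-congˡ (sum-zero λ j → t≈0 _ (Fin.punchInᵢ≢i i j)) ⟩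
    t i + 0ℂ                   ≈⟨ +-identityʳ (t i) ⟩
    t i                        ∎
    where open SetoidReasoning setoid

  -- At most one term survives. The value `z` can be an entry of `H` or an indicator, fixed before
  -- it is known whether any index satisfies `P`; the last hypothesis settles the case where none
  -- does.
  sum-unique : ∀ {n z} {P : Fin n → Set p} {t : Vector ℂ n} →
    (∀ i → Dec (P i)) → (∀ {i j} → P i → P j → i ≡ j) →
    (∀ {i} → P i → t i ≈ z) → (∀ {i} → ¬ P i → t i ≈ 0ℂ) →
    ((∀ i → ¬ P i) → z ≈ 0ℂ) → sum t ≈ z
  sum-unique P? unique on off none with Fin.any? P?
  ... | yes (i , pᵢ) = trans (sum-single i λ j j≢i → off λ pⱼ → j≢i (unique pⱼ pᵢ)) (on pᵢ)
  ... | no ¬∃p       = trans (sum-zero λ i → off λ pᵢ → ¬∃p (i , pᵢ))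
                             (sym (none λ i pᵢ → ¬∃p (i , pᵢ)))

  𝟙 : {P : Set p} → Dec P → ℂ
  𝟙 P? = if does P? then 1ℂ else 0ℂ

  𝟙-yes : {P : Set p} (P? : Dec P) → P → 𝟙 P? ≈ 1ℂ
  𝟙-yes P? p = reflexive (if-yes P? p)

  𝟙-no : {P : Set p} (P? : Dec P) → ¬ P → 𝟙 P? ≈ 0ℂ
  𝟙-no P? ¬p = reflexive (if-no P? ¬p)

  𝟙-⊎ : {P : Set p} {Q : Set q} (P? : Dec P) (Q? : Dec Q) → (P → ¬ Q) →
        𝟙 (P? ⊎-dec Q?) ≈ 𝟙 P? + 𝟙 Q?
  𝟙-⊎ (yes p) (yes q) disjoint = contradiction q (disjoint p)
  𝟙-⊎ (yes _) (no _)  _        = sym (+-identityʳ 1ℂ)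
  𝟙-⊎ (no _)  (yes _) _        = sym (+-identityˡ 1ℂ)
  𝟙-⊎ (no _)  (no _)  _        = sym (+-identityˡ 0ℂ)

  sum-𝟙 : ∀ {n} {P : Fin n → Set p} (P? : ∀ i → Dec (P i)) {i} → P i →
          (∀ {j} → P j → j ≡ i) → sum (λ j → 𝟙 (P? j)) ≈ 1ℂ
  sum-𝟙 P? {i} pᵢ unique =
    trans (sum-single i λ j j≢i → 𝟙-no (P? j) (j≢i ∘ unique)) (𝟙-yes (P? i) pᵢ)

  -- The list `allFin n` is a tabulation of the identity, and its tail tabulates a shifted function.
  -- The induction therefore needs an arbitrary `f`.
  count : ∀ {n} {A : Set a} {P : A → Set p} (P? : ∀ x → Dec (P x)) (f : Fin n → A) →
          sum (λ i → 𝟙 (P? (f i))) ≈ fromℕ (length (filter P? (tabulate f)))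
  count {n = zero}  P? f = refl
  count {n = suc n} P? f with P? (f zero)
  ... | yes _ = +-congˡ (count P? (f ∘ suc))
  ... | no _  = trans (+-identityˡ _) (count P? (f ∘ suc))

  ·-I : ∀ {n} z → z · I {n} ≋ diag λ _ → z
  ·-I z i j with i Fin.≟ j
  ... | yes _ = *-identityʳ z
  ... | no _  = *-zeroʳ z

  -- Splits each of the two identities into its diagonal and its off-diagonal entries, with `N` an
  -- adjacency matrix, whose diagonal vanishes.
  ≋-⊕-diag : ∀ {n} (M N : Matrix n n) {d : Vector ℂ n} →
    (∀ i → N i i ≈ 0ℂ) → (∀ i → M i i ≈ d i) → (∀ {i j} → i ≢ j → M i j ≈ N i j) → M ≋ N ⊕ diag d
  ≋-⊕-diag M N {d} N≈0 M≈d M≈N i j with i Fin.≟ j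
  ... | yes ≡.refl = trans (M≈d i) (sym (trans (+-congʳ (N≈0 i)) (+-identityˡ (d i))))
  ... | no i≢j     = trans (M≈N i≢j) (sym (+-identityʳ (N i j)))

-- The multiplication table of 1, `γ` and `conj γ`.

module CubeRoots {c ℓ₁ ℓ₂} (ℝ : RealNumbers c ℓ₁ ℓ₂)
  (√3 : RealNumbers.Carrier ℝ)
  (√3²≈3 : RealNumbers._≈_ ℝ (RealNumbers._*_ ℝ √3 √3) (RealNumbers.fromℕ ℝ 3)) where
  private module ℝ = RealNumbers ℝ
  open ComplexNumbers ℝ
  open ComplexProperties ℝ

  γ : ℂ
  γ = e^2πi/3 √3

  module _ where
    open CommutativeRing ℝ.commutativeRing using ()
      renaming (_+_ to _⊞_; _*_ to _⊠_; -_ to ⊟_; _≈_ to _≃_)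
    private module R where
      open CommutativeRing ℝ.commutativeRing public
      open RingProperties ring public
    open SetoidReasoning R.setoid

    ½ ¼ β : ℝ.Carrier
    ½ = ℝ.½
    ¼ = ½ ⊠ ½
    β = ½ ⊠ √3

    ½+½≈1 : ½ ⊞ ½ ≃ R.1#
    ½+½≈1 = begin
      ½ ⊞ ½                            ≈⟨ R.+-cong (R.*-identityʳ ½) (R.*-identityʳ ½) ⟨
      ½ ⊠ R.1# ⊞ ½ ⊠ R.1#              ≈⟨ R.distribˡ ½ R.1# R.1# ⟨
      -- `½` comes from the apartness of 2 and 0, which makes the difference 2 - 0 invertible, so
      -- the zero is inserted first.
      ½ ⊠ (R.1# ⊞ R.1#)                ≈⟨ R.*-congˡ (R.trans (R.+-congˡ R.-0#≈0#) (R.+-identityʳ _)) ⟨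
      ½ ⊠ ((R.1# ⊞ R.1#) ⊞ ⊟ R.0#)     ≈⟨ proj₁ (proj₂ (ℝ.#⇒invertible
        (Equivalence.from (ℝ.#⇔< (R.1# ⊞ R.1#) R.0#) (inj₂ ℝ.0<2)))) ⟩
      R.1#                             ∎

    x½+x½≈x : ∀ x → x ⊠ ½ ⊞ x ⊠ ½ ≃ x
    x½+x½≈x x = begin
      x ⊠ ½ ⊞ x ⊠ ½  ≈⟨ R.distribˡ x ½ ½ ⟨
      x ⊠ (½ ⊞ ½)    ≈⟨ R.*-congˡ ½+½≈1 ⟩
      x ⊠ R.1#       ≈⟨ R.*-identityʳ x ⟩
      x              ∎

    ½²≈¼ : ⊟ ½ ⊠ ⊟ ½ ≃ ¼
    ½²≈¼ = begin
      ⊟ ½ ⊠ ⊟ ½     ≈⟨ R.-‿distribˡ-* ½ (⊟ ½) ⟨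
      ⊟ (½ ⊠ ⊟ ½)   ≈⟨ R.-‿cong (R.-‿distribʳ-* ½ ½) ⟨
      ⊟ (⊟ ¼)       ≈⟨ R.-‿involutive ¼ ⟩
      ¼             ∎

    -- The square is a quarter of the square of `√3`. Three quarters are written as `¼ ⊞ ½` so that
    -- `¼` cancels against the square of the real part in `γ*γ`.
    β²≈¾ : β ⊠ β ≃ ¼ ⊞ ½
    β²≈¾ = begin
      ½ ⊠ √3 ⊠ (½ ⊠ √3)              ≈⟨ R.*-assoc ½ √3 _ ⟩
      ½ ⊠ (√3 ⊠ (½ ⊠ √3))            ≈⟨ R.*-congˡ (R.*-congˡ (R.*-comm ½ √3)) ⟩
      ½ ⊠ (√3 ⊠ (√3 ⊠ ½))            ≈⟨ R.*-congˡ (R.*-assoc √3 √3 ½) ⟨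
      ½ ⊠ ((√3 ⊠ √3) ⊠ ½)            ≈⟨ R.*-congˡ (R.*-comm _ ½) ⟩
      ½ ⊠ (½ ⊠ (√3 ⊠ √3))            ≈⟨ R.*-assoc ½ ½ _ ⟨
      ¼ ⊠ (√3 ⊠ √3)                  ≈⟨ R.*-congˡ √3²≈3 ⟩
      ¼ ⊠ (R.1# ⊞ (R.1# ⊞ (R.1# ⊞ R.0#)))
        ≈⟨ R.*-congˡ (R.+-congˡ (R.+-congˡ (R.+-identityʳ R.1#))) ⟩
      ¼ ⊠ (R.1# ⊞ (R.1# ⊞ R.1#))     ≈⟨ R.distribˡ ¼ R.1# _ ⟩
      ¼ ⊠ R.1# ⊞ ¼ ⊠ (R.1# ⊞ R.1#)   ≈⟨ R.+-cong (R.*-identityʳ ¼) (R.distribˡ ¼ R.1# R.1#) ⟩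
      ¼ ⊞ (¼ ⊠ R.1# ⊞ ¼ ⊠ R.1#)
        ≈⟨ R.+-congˡ (R.trans (R.+-cong (R.*-identityʳ ¼) (R.*-identityʳ ¼)) (x½+x½≈x ½)) ⟩
      ¼ ⊞ ½                          ∎

    -- The real part is 1/4 - 3/4 = -1/2, and the imaginary part is twice -β/2. Together with
    -- `γ*conjγ` this yields γ³ = 1.
    γ*γ : γ * γ ≈ conj γ
    γ*γ = real , imaginary
      where
      real : ⊟ ½ ⊠ ⊟ ½ ⊞ ⊟ (β ⊠ β) ≃ ⊟ ½
      real = begin
        ⊟ ½ ⊠ ⊟ ½ ⊞ ⊟ (β ⊠ β)  ≈⟨ R.+-cong ½²≈¼ (R.-‿cong β²≈¾) ⟩
        ¼ ⊞ ⊟ (¼ ⊞ ½)          ≈⟨ R.+-congˡ (R.-‿+-comm ¼ ½) ⟨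
        ¼ ⊞ (⊟ ¼ ⊞ ⊟ ½)        ≈⟨ R.+-assoc ¼ (⊟ ¼) (⊟ ½) ⟨
        (¼ ⊞ ⊟ ¼) ⊞ ⊟ ½        ≈⟨ R.+-congʳ (R.-‿inverseʳ ¼) ⟩
        R.0# ⊞ ⊟ ½             ≈⟨ R.+-identityˡ (⊟ ½) ⟩
        ⊟ ½                    ∎

      imaginary : ⊟ ½ ⊠ β ⊞ β ⊠ ⊟ ½ ≃ ⊟ β
      imaginary = begin
        ⊟ ½ ⊠ β ⊞ β ⊠ ⊟ ½        ≈⟨ R.+-congʳ (R.*-comm (⊟ ½) β) ⟩
        β ⊠ ⊟ ½ ⊞ β ⊠ ⊟ ½        ≈⟨ R.+-cong (R.-‿distribʳ-* β ½) (R.-‿distribʳ-* β ½) ⟨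
        ⊟ (β ⊠ ½) ⊞ ⊟ (β ⊠ ½)    ≈⟨ R.-‿+-comm (β ⊠ ½) (β ⊠ ½) ⟩
        ⊟ (β ⊠ ½ ⊞ β ⊠ ½)        ≈⟨ R.-‿cong (x½+x½≈x β) ⟩
        ⊟ β                      ∎

    -- The squared modulus is 1/4 + 3/4.
    γ*conjγ : γ * conj γ ≈ 1ℂ
    γ*conjγ = real , imaginary
      where
      real : ⊟ ½ ⊠ ⊟ ½ ⊞ ⊟ (β ⊠ ⊟ β) ≃ R.1#
      real = begin
        ⊟ ½ ⊠ ⊟ ½ ⊞ ⊟ (β ⊠ ⊟ β)
          ≈⟨ R.+-cong ½²≈¼ (R.trans (R.-‿cong (R.sym (R.-‿distribʳ-* β β))) (R.-‿involutive _)) ⟩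
        ¼ ⊞ β ⊠ β      ≈⟨ R.+-congˡ β²≈¾ ⟩
        ¼ ⊞ (¼ ⊞ ½)    ≈⟨ R.+-assoc ¼ ¼ ½ ⟨
        (¼ ⊞ ¼) ⊞ ½    ≈⟨ R.+-congʳ (x½+x½≈x ½) ⟩
        ½ ⊞ ½          ≈⟨ ½+½≈1 ⟩
        R.1#           ∎

      imaginary : ⊟ ½ ⊠ ⊟ β ⊞ β ⊠ ⊟ ½ ≃ R.0#
      imaginary = begin
        ⊟ ½ ⊠ ⊟ β ⊞ β ⊠ ⊟ ½      ≈⟨ R.+-cong (R.*-comm (⊟ ½) (⊟ β)) R.refl ⟩
        ⊟ β ⊠ ⊟ ½ ⊞ β ⊠ ⊟ ½      ≈⟨ R.distribʳ (⊟ ½) (⊟ β) β ⟨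
        (⊟ β ⊞ β) ⊠ ⊟ ½          ≈⟨ R.*-congʳ (R.-‿inverseˡ β) ⟩
        R.0# ⊠ ⊟ ½               ≈⟨ R.zeroˡ (⊟ ½) ⟩
        R.0#                     ∎

  ⟦_⟧ : Root → ℂ
  ⟦ one ⟧ = 1ℂ
  ⟦ ω ⟧   = γ
  ⟦ ω² ⟧  = conj γ

  conj-⟦⟧ : ∀ r → conj ⟦ r ⟧ ≈ ⟦ inv r ⟧
  conj-⟦⟧ one = conj-1
  conj-⟦⟧ ω   = refl
  conj-⟦⟧ ω²  = conj-involutive γ

  -- Moves every product of nonzero entries into `Root`, where it is settled by computation. The
  -- cases not covered by `γ*γ` and `γ*conjγ` follow by unit laws, commutativity or conjugation.
  ⟦⟧-∙ : ∀ r s → ⟦ r ⟧ * ⟦ s ⟧ ≈ ⟦ r ∙ s ⟧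
  ⟦⟧-∙ one s   = *-identityˡ ⟦ s ⟧
  ⟦⟧-∙ ω   one = *-identityʳ γ
  ⟦⟧-∙ ω   ω   = γ*γ
  ⟦⟧-∙ ω   ω²  = γ*conjγ
  ⟦⟧-∙ ω²  one = *-identityʳ (conj γ)
  ⟦⟧-∙ ω²  ω   = trans (*-comm (conj γ) γ) γ*conjγ
  ⟦⟧-∙ ω²  ω²  = trans (conj-* γ γ) (trans (conj-cong γ*γ) (conj-involutive γ))

-- Entries of `H` and `B`, and the product B B*.

module IncidenceProducts {c ℓ₁ ℓ₂} (ℝ : RealNumbers c ℓ₁ ℓ₂)
  (√3 : RealNumbers.Carrier ℝ)
  (√3²≈3 : RealNumbers._≈_ ℝ (RealNumbers._*_ ℝ √3 √3) (RealNumbers.fromℕ ℝ 3)) where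
  open ComplexNumbers ℝ
  open ComplexProperties ℝ
  open CubeRoots ℝ √3 √3²≈3
  open GraphMatrices ℝ

  module _ {n} (D : MixedGraph n) where
    open MixedGraph D
    open Combinatorics D

    -- The alternatives tested by `H` exclude one another, so those tested earlier can be refuted.
    -- The lemma serves `D` in identity (ii) and `L D` in identity (i).
    H-phase : ∀ {u v} r → Phase u v r → H γ D u v ≡ ⟦ r ⟧
    H-phase {u} {v} one d = if-yes (digon? u v) d
    H-phase {u} {v} ω   a = ≡.trans (if-no (digon? u v) λ (_ , ¬a , _) → ¬a a)
                                    (if-yes (u ⇒? v) a)
    H-phase {u} {v} ω²  a = ≡.trans (if-no (digon? u v) λ (_ , _ , ¬a) → ¬a a)
                           (≡.trans (if-no (u ⇒? v) (asym a))
                                    (if-yes (v ⇒? u) a))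

    H-nonadjacent : ∀ {u v} → ¬ u ~ v → H γ D u v ≡ 0ℂ
    H-nonadjacent {u} {v} u≁v = ≡.trans (if-no (digon? u v) (u≁v ∘ proj₁))
                               (≡.trans (if-no (u ⇒? v) (u≁v ∘ ⇒-~))
                                        (if-no (v ⇒? u) (u≁v ∘ symm ∘ ⇒-~)))

    H-diagonal : ∀ v → H γ D v v ≈ 0ℂ
    H-diagonal v = reflexive (H-nonadjacent irrefl)

    B-role : ∀ {v e} r → Role v e r → B γ D v e ≡ ⟦ r ⟧
    B-role {v} {e} one d = if-yes (digonAt? v e) d
    B-role {v} {e} ω   h = ≡.trans (if-no (digonAt? v e) (¬head×digon h))
                                   (if-yes (head? v e) h)
    B-role {v} {e} ω²  t = ≡.trans (if-no (digonAt? v e) (¬tail×digon t))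
                          (≡.trans (if-no (head? v e) λ h → ¬head×tail h t)
                                   (if-yes (tail? v e) t))

    B-nonincident : ∀ {v e} → ¬ Incident v e → B γ D v e ≡ 0ℂ
    B-nonincident {v} {e} v∉e = ≡.trans (if-no (digonAt? v e) (v∉e ∘ proj₁))
                               (≡.trans (if-no (head? v e) (v∉e ∘ head-incident))
                                        (if-no (tail? v e) (v∉e ∘ tail-incident)))

    conjB-role : ∀ {v e} r → Role v e r → conj (B γ D v e) ≈ ⟦ inv r ⟧
    conjB-role r x = trans (conj-cong (reflexive (B-role r x))) (conj-⟦⟧ r)

    conjB-nonincident : ∀ {v e} → ¬ Incident v e → conj (B γ D v e) ≈ 0ℂ
    conjB-nonincident v∉e = trans (conj-cong (reflexive (B-nonincident v∉e))) conj-0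

    B*conjB : ∀ {u v e} r s → Role u e r → Role v e s →
              B γ D u e * conj (B γ D v e) ≈ ⟦ r ∙ inv s ⟧
    B*conjB r s x y =
      trans (*-cong (reflexive (B-role r x)) (conjB-role s y)) (⟦⟧-∙ r (inv s))

    conjB*B : ∀ {v e f} r s → Role v e r → Role v f s →
              conj (B γ D v e) * B γ D v f ≈ ⟦ inv r ∙ s ⟧
    conjB*B r s x y =
      trans (*-cong (conjB-role r x) (reflexive (B-role s y))) (⟦⟧-∙ (inv r) s)

    B*-nonincident : ∀ {v e} z → ¬ Incident v e → B γ D v e * z ≈ 0ℂ
    B*-nonincident z v∉e = trans (*-cong (reflexive (B-nonincident v∉e)) refl) (*-zeroˡ z)

    -- A nonzero entry is a root of unity, and r · r⁻¹ = 1. The decision is a parameter so that a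
    -- known incidence can be supplied as well as the test `incident?`.
    B*conjB-𝟙 : ∀ {v e} (v∈?e : Dec (Incident v e)) → B γ D v e * conj (B γ D v e) ≈ 𝟙 v∈?e
    B*conjB-𝟙 (yes v∈e) with r , x ← role v∈e =
      trans (B*conjB r r x x) (reflexive (≡.cong ⟦_⟧ (∙-inverseʳ r)))
    B*conjB-𝟙 (no v∉e)  = B*-nonincident _ v∉e

    -- A nonzero term needs an edge incident with both vertices; as these are distinct, it joins
    -- them. Its term is r⁻¹ · r⁻¹ = r, the phase of the pair.
    BBᴴ-offdiagonal : ∀ {u v} → u ≢ v → (B γ D ⊗ (B γ D) ᴴ) u v ≈ H γ D u v
    BBᴴ-offdiagonal {u} {v} u≢v = sum-unique (joins? u v) joins-injective
      on (λ {e} → off (incident? u e) (incident? v e)) none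
      where
      on : ∀ {e} → Joins u v e → B γ D u e * conj (B γ D v e) ≈ H γ D u v
      on j with r , x , y , ph ← joins-phase j =
        trans (B*conjB (inv r) r x y)
              (reflexive (≡.trans (≡.cong ⟦_⟧ (inv∙inv r)) (≡.sym (H-phase r ph))))

      off : ∀ {e} → Dec (Incident u e) → Dec (Incident v e) → ¬ Joins u v e →
            B γ D u e * conj (B γ D v e) ≈ 0ℂ
      off (no u∉e)  _         _  = B*-nonincident _ u∉e
      off (yes _)   (no v∉e)  _  = trans (*-cong refl (conjB-nonincident v∉e)) (*-zeroʳ _)
      off (yes u∈e) (yes v∈e) ¬j = ⊥-elim (¬j (incident×incident⇒joins u≢v u∈e v∈e))

      none : (∀ e → ¬ Joins u v e) → H γ D u v ≈ 0ℂ
      none ¬j = reflexive (H-nonadjacent λ u~v → ¬j _ (proj₂ (~⇒joins u~v)))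

    -- Both sides count the pairs (e , w) such that e joins v to w.
    BBᴴ-diagonal : ∀ v → (B γ D ⊗ (B γ D) ᴴ) v v ≈ fromℕ (deg v)
    BBᴴ-diagonal v = begin
      -- The product sums over edges, whereas `deg` counts neighbours. An edge at `v` has exactly
      -- one opposite end, so its term 1 expands into a sum over `w`.
      sum (λ e → B γ D v e * conj (B γ D v e))       ≈⟨ sum-cong-≋ (λ e → sym (neighbours e)) ⟩
      sum (λ e → sum λ w → 𝟙 (joins? v w e))         ≈⟨ ∑-comm (λ e w → 𝟙 (joins? v w e)) ⟩
      sum (λ w → sum λ e → 𝟙 (joins? v w e))         ≈⟨ sum-cong-≋ joining ⟩
      sum (λ w → 𝟙 (v ~? w))                         ≈⟨ count (v ~?_) (λ w → w) ⟩
      fromℕ (deg v)                                  ∎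
      where
      open SetoidReasoning setoid

      neighbours : ∀ e → sum (λ w → 𝟙 (joins? v w e)) ≈ B γ D v e * conj (B γ D v e)
      neighbours e = sum-unique (λ w → joins? v w e) joins-functional
        (λ {w} j → trans (𝟙-yes (joins? v w e) j) (sym (B*conjB-𝟙 (yes (joins⇒incident j)))))
        (λ {w} ¬j → 𝟙-no (joins? v w e) ¬j)
        (λ ¬j → B*-nonincident _ λ v∈e → ¬j _ (proj₂ (incident⇒joins v∈e)))

      -- After the exchange the inner sum is 0 or 1, since the graph is simple.
      joining : ∀ w → sum (λ e → 𝟙 (joins? v w e)) ≈ 𝟙 (v ~? w)
      joining w = sum-unique (joins? v w) joins-injective
        (λ {e} j → trans (𝟙-yes (joins? v w e) j) (sym (𝟙-yes (v ~? w) (joins⇒~ j))))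
        (λ {e} ¬j → 𝟙-no (joins? v w e) ¬j)
        (λ ¬j → 𝟙-no (v ~? w) λ v~w → ¬j _ (proj₂ (~⇒joins v~w)))

    BBᴴ : B γ D ⊗ (B γ D) ᴴ ≋ H γ D ⊕ degreeMatrix D
    BBᴴ = ≋-⊕-diag _ _ H-diagonal BBᴴ-diagonal BBᴴ-offdiagonal

  -- The product B* B and the line graph.

  module _ {n} (D : MixedGraph n) where
    open MixedGraph D
    open Combinatorics D
    open LineGraph D

    -- Only a common vertex contributes, and distinct edges have at most one. There the term r⁻¹ · s
    -- is the line graph entry by `line-phase`; without a common vertex the edges are not adjacent
    -- and both sides vanish.
    BᴴB-offdiagonal : ∀ {e f} → e ≢ f → ((B γ D) ᴴ ⊗ B γ D) e f ≈ H γ (L D) e f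
    BᴴB-offdiagonal {e} {f} e≢f = sum-unique
      (λ v → incident? v e ×-dec incident? v f)
      (λ (u∈e , u∈f) (v∈e , v∈f) → shared-vertex-unique e≢f u∈e u∈f v∈e v∈f)
      on (λ {v} → off (incident? v f)) none
      where
      on : ∀ {v} → Incident v e × Incident v f → conj (B γ D v e) * B γ D v f ≈ H γ (L D) e f
      on (v∈e , v∈f) with r , x ← role v∈e | s , y ← role v∈f =
        trans (conjB*B D r s x y)
              (sym (reflexive (H-phase (L D) (inv r ∙ s) (line-phase r s e≢f x y))))

      off : ∀ {v} → Dec (Incident v f) → ¬ (Incident v e × Incident v f) →
            conj (B γ D v e) * B γ D v f ≈ 0ℂ
      off (no v∉f)  _    = trans (*-comm _ _) (B*-nonincident D _ v∉f)
      off (yes v∈f) ¬vef =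
        trans (*-cong (conjB-nonincident D λ v∈e → ¬vef (v∈e , v∈f)) refl) (*-zeroˡ _)

      none : (∀ v → ¬ (Incident v e × Incident v f)) → H γ (L D) e f ≈ 0ℂ
      none ¬vef = reflexive (H-nonadjacent (L D) λ (_ , v , vef) → ¬vef v vef)

    BᴴB-diagonal : ∀ e → ((B γ D) ᴴ ⊗ B γ D) e e ≈ fromℕ 2
    BᴴB-diagonal e = begin
      sum (λ v → conj (B γ D v e) * B γ D v e)
        ≈⟨ sum-cong-≋ endpoints ⟩
      sum (λ v → 𝟙 (v Fin.≟ end₁ e) + 𝟙 (v Fin.≟ end₂ e))
        ≈⟨ ∑-distrib-+ (λ v → 𝟙 (v Fin.≟ end₁ e)) _ ⟩
      sum (λ v → 𝟙 (v Fin.≟ end₁ e)) + sum (λ v → 𝟙 (v Fin.≟ end₂ e))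
        ≈⟨ +-cong (sum-𝟙 (Fin._≟ end₁ e) ≡.refl λ p → p) (sum-𝟙 (Fin._≟ end₂ e) ≡.refl λ p → p) ⟩
      1ℂ + 1ℂ
        -- `fromℕ 2` unfolds to 1 + (1 + 0).
        ≈⟨ +-congˡ (+-identityʳ 1ℂ) ⟨
      fromℕ 2 ∎
      where
      open SetoidReasoning setoid

      endpoints : ∀ v → conj (B γ D v e) * B γ D v e ≈ 𝟙 (v Fin.≟ end₁ e) + 𝟙 (v Fin.≟ end₂ e)
      -- Commuting the factors gives a diagonal term of B B*, hence the indicator of incidence.
      -- `incident?` is by definition a disjunction of two equality tests, and these exclude each
      -- other because the ends of an edge differ.
      endpoints v = trans (*-comm _ _) (trans (B*conjB-𝟙 D (incident? v e))
        (𝟙-⊎ (v Fin.≟ end₁ e) (v Fin.≟ end₂ e)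
          λ p q → end₁≢end₂ e (≡.trans (≡.sym p) q)))

    BᴴB : (B γ D) ᴴ ⊗ B γ D ≋ H γ (L D) ⊕ fromℕ 2 · I
    BᴴB e f = trans
      (≋-⊕-diag _ _ (H-diagonal (L D)) BᴴB-diagonal BᴴB-offdiagonal e f)
      (sym (+-congˡ (·-I (fromℕ 2) e f)))

theorem8 : ∀ {c ℓ₁ ℓ₂ : Level} (ℝ : RealNumbers c ℓ₁ ℓ₂) →
    let module ℝ = RealNumbers ℝ
        open ComplexNumbers ℝ
        open GraphMatrices ℝ
    in (√3 : ℝ.Carrier) → ℝ.0# ℝ.< √3 → √3 ℝ.* √3 ℝ.≈ ℝ.fromℕ 3 →
       (n : ℕ) (D : MixedGraph n) →
       let γ = e^2πi/3 √3
       in ((B γ D) ᴴ ⊗ B γ D ≋ H γ (L D) ⊕ fromℕ 2 · I)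
          × (B γ D ⊗ (B γ D) ᴴ ≋ H γ D ⊕ degreeMatrix D)
theorem8 ℝ √3 _ √3²≈3 n D = BᴴB D , BBᴴ D
  where open IncidenceProducts ℝ √3 √3²≈3
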